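{- Let $M$ be a countable set-homogeneous structure. Then $M$ is uniformly homogeneous if and only if for every finitely generated substructure $A$ of $M$ there exists a group homomorphism $E_A\colon \operatorname{Aut}(A)\to\operatorname{Aut}(M)$ such that $E_A(h)$ is an extension of $h$ for every $h\in\operatorname{Aut}(A)$.
   Context: A structure is a model of a fixed countable first-order language, possibly involving algebraic operations (function symbols and constants) as well as relations. A substructure of $M$ is a subset closed under all operations of $M$ (in particular containing all constants), with the induced relations. $\operatorname{Aut}(M)$ denotes the automorphism group of $M$. A structure $M$ is set-homogeneous if for every two isomorphic finitely generated substructures $A$ and $B$ of $M$ there is an automorphism $f$ of $M$ such that $f[A]=B$. A structure $M$ is uniformly homogeneous if there is a functor $K$ from the category of all isomorphisms between finitely generated substructures of $M$ into the group $\operatorname{Aut}(M)$ (viewed as a category with a single object) such that $K(f)$ is an extension of $f$ for each $f$. Equivalently, $K$ assigns to each isomorphism $f$ between finitely generated substructures of $M$ a map $K(f)$ so that: (1) $K(\mathrm{id}_A)=\mathrm{id}_M$; (2) $K(f)\in\operatorname{Aut}(M)$ and $K(f)$ extends $f$; (3) $K(f\circ g)=K(f)\circ K(g)$, for all isomorphisms $f\colon A\to B$, $g\colon C\to A$ with $A,B,C$ finitely generated substructures of $M$. -}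

module Defs where

open import Level using (Level; suc)
open import Algebra.Bundles using (Group)
open import Data.List.Base using (List)
open import Data.List.Relation.Unary.Any using (Any)
open import Data.Nat.Base using (ℕ)
open import Data.Product.Base using (Σ; ∃; _×_; _,_; proj₁; proj₂)
open import Data.Vec.Functional using (Vector)
open import Function.Base using (_∘_)
open import Function.Bundles using (Inverse; Injection; _↣_; _⇔_; mk⇔; Equivalence)
import Function.Construct.Composition as Comp
import Function.Construct.Identity as Id
import Function.Construct.Symmetry as Sym
open import Relation.Binary.Bundles using (Setoid)
import Relation.Binary.Construct.On as On
import Relation.Binary.PropositionalEquality as ≡
open import Relation.Unary using (Pred; _∈_; _≐_)

private
  variable
    ℓ : Level

-- Constants are the function symbols of arity 0.
record Language (ℓ : Level) : Set (suc ℓ) where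
  field
    Func           : ℕ → Set ℓ
    Rel            : ℕ → Set ℓ
    Func-countable : Σ ℕ Func ↣ ℕ
    Rel-countable  : Σ ℕ Rel ↣ ℕ

-- The carrier is a setoid, whose _≈_ plays the role of equality; this lets a
-- substructure be a structure in its own right, its elements being identified
-- regardless of their membership proofs.
record Structure (L : Language ℓ) : Set (suc ℓ) where
  open Language L
  field
    setoid : Setoid ℓ ℓ

  open Setoid setoid public

  field
    fun      : ∀ {n} → Func n → Vector Carrier n → Carrier
    fun-cong : ∀ {n} (s : Func n) {u v : Vector Carrier n} →
               (∀ i → u i ≈ v i) → fun s u ≈ fun s v
    rel      : ∀ {n} → Rel n → Pred (Vector Carrier n) ℓ
    rel-resp : ∀ {n} (r : Rel n) {u v : Vector Carrier n} →
               (∀ i → u i ≈ v i) → rel r u → rel r v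

-- Finite structures, including the empty one, count as countable.
Countable : {L : Language ℓ} → Structure L → Set ℓ
Countable M = Injection (Structure.setoid M) (≡.setoid ℕ)

infix 4 _≅_

record _≅_ {L : Language ℓ} (M N : Structure L) : Set ℓ where
  open Language L
  private
    module M = Structure M
    module N = Structure N
  field
    underlying : Inverse M.setoid N.setoid

  open Inverse underlying public

  field
    preserves-fun : ∀ {n} (s : Func n) (v : Vector M.Carrier n) →
                    to (M.fun s v) N.≈ N.fun s (to ∘ v)
    preserves-rel : ∀ {n} (r : Rel n) (v : Vector M.Carrier n) →
                    M.rel r v ⇔ N.rel r (to ∘ v)

module _ {L : Language ℓ} where

  ≅-refl : (M : Structure L) → M ≅ M
  ≅-refl M = record
    { underlying    = Id.inverse setoid
    ; preserves-fun = λ s v → refl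
    ; preserves-rel = λ r v → mk⇔ (λ p → p) (λ p → p)
    } where open Structure M

  ≅-sym : {M N : Structure L} → M ≅ N → N ≅ M
  ≅-sym {M} {N} f = record
    { underlying    = Sym.inverse f.underlying
    ; preserves-fun = λ s v → f.inverseʳ (N.trans
        (N.fun-cong s (λ i → N.sym (f.inverseˡ M.refl)))
        (N.sym (f.preserves-fun s (f.from ∘ v))))
    ; preserves-rel = λ r v → mk⇔
        (λ p → Equivalence.from (f.preserves-rel r (f.from ∘ v))
                 (N.rel-resp r (λ i → N.sym (f.inverseˡ M.refl)) p))
        (λ p → N.rel-resp r (λ i → f.inverseˡ M.refl)
                 (Equivalence.to (f.preserves-rel r (f.from ∘ v)) p))
    }
    where
      module M = Structure M
      module N = Structure N
      module f = _≅_ f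

  infixr 9 _∘≅_

  _∘≅_ : {M N P : Structure L} → N ≅ P → M ≅ N → M ≅ P
  _∘≅_ {P = P} f g = record
    { underlying    = Comp.inverse g.underlying f.underlying
    ; preserves-fun = λ s v → P.trans (f.to-cong (g.preserves-fun s v))
                                      (f.preserves-fun s (g.to ∘ v))
    ; preserves-rel = λ r v →
        Comp.equivalence (g.preserves-rel r v) (f.preserves-rel r (g.to ∘ v))
    }
    where
      module P = Structure P
      module f = _≅_ f
      module g = _≅_ g

  Aut : Structure L → Group ℓ ℓ
  Aut M = record
    { Carrier = M ≅ M
    ; _≈_     = λ f g → ∀ x → _≅_.to f x ≈ _≅_.to g x
    ; _∙_     = _∘≅_
    ; ε       = ≅-refl M
    ; _⁻¹     = ≅-sym
    ; isGroup = record
      { isMonoid = record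
        { isSemigroup = record
          { isMagma = record
            { isEquivalence = record
              { refl  = λ x → refl
              ; sym   = λ p x → sym (p x)
              ; trans = λ p q x → trans (p x) (q x)
              }
            ; ∙-cong = λ {f} {f′} {g} {g′} p q x →
                trans (_≅_.to-cong f (q x)) (p (_≅_.to g′ x))
            }
          ; assoc = λ f g h x → refl
          }
        ; identity = (λ f x → refl) , (λ f x → refl)
        }
      ; inverse = (λ f x → _≅_.inverseʳ f refl) , (λ f x → _≅_.inverseˡ f refl)
      ; ⁻¹-cong = λ {f} {g} p x → _≅_.inverseʳ f
          (trans (sym (_≅_.inverseˡ g refl)) (sym (p (_≅_.from g x))))
      }
    } where open Structure M

module _ {L : Language ℓ} (M : Structure L) where
  open Language L
  open Structure M

  record Substructure : Set (suc ℓ) where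
    field
      pred   : Pred Carrier ℓ
      resp   : ∀ {x y} → x ≈ y → x ∈ pred → y ∈ pred
      closed : ∀ {n} (s : Func n) (v : Vector Carrier n) →
               (∀ i → v i ∈ pred) → fun s v ∈ pred

  data Generated (xs : List Carrier) : Pred Carrier ℓ where
    generator : ∀ {x} → Any (x ≈_) xs → Generated xs x
    operation : ∀ {n} (s : Func n) (v : Vector Carrier n) →
                (∀ i → Generated xs (v i)) → Generated xs (fun s v)
    respects  : ∀ {x y} → x ≈ y → Generated xs x → Generated xs y

  record FGSubstructure : Set (suc ℓ) where
    field
      substructure : Substructure

    open Substructure substructure public

    field
      finitelyGenerated : ∃ λ xs → pred ≐ Generated xs

module _ {L : Language ℓ} {M : Structure L} where
  open Structure M
  open FGSubstructure using (pred)

  -- Elements are pairs (x , p) with p a membership proof, which _≈_ ignores.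
  ⟦_⟧ : FGSubstructure M → Structure L
  ⟦ A ⟧ = record
    { setoid   = On.setoid {B = ∃ (pred A)} setoid proj₁
    ; fun      = λ s v → fun s (proj₁ ∘ v)
                       , FGSubstructure.closed A s (proj₁ ∘ v) (proj₂ ∘ v)
    ; fun-cong = λ s p → fun-cong s p
    ; rel      = λ r v → rel r (proj₁ ∘ v)
    ; rel-resp = λ r p → rel-resp r p
    }

  image : M ≅ M → Pred Carrier ℓ → Pred Carrier ℓ
  image f P y = ∃ λ x → x ∈ P × _≅_.to f x ≈ y

  Extends : (A B : FGSubstructure M) → M ≅ M → ⟦ A ⟧ ≅ ⟦ B ⟧ → Set ℓ
  Extends A B F f = ∀ a → _≅_.to F (proj₁ a) ≈ proj₁ (_≅_.to f a)

  -- Equality of isomorphisms as arrows: equal domains and codomains (as subsets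
  -- of M), and equal values.
  record SameArrow (A B A′ B′ : FGSubstructure M)
                   (f : ⟦ A ⟧ ≅ ⟦ B ⟧) (f′ : ⟦ A′ ⟧ ≅ ⟦ B′ ⟧) : Set ℓ where
    field
      dom : pred A ≐ pred A′
      cod : pred B ≐ pred B′
      val : ∀ x (p : x ∈ pred A) (p′ : x ∈ pred A′) →
            proj₁ (_≅_.to f (x , p)) ≈ proj₁ (_≅_.to f′ (x , p′))

module _ {L : Language ℓ} (M : Structure L) where
  open Group (Aut M) using (_≈_; _∙_; ε)
  open FGSubstructure using (pred)

  SetHomogeneous : Set (suc ℓ)
  SetHomogeneous = (A B : FGSubstructure M) → ⟦ A ⟧ ≅ ⟦ B ⟧ →
                   ∃ λ (f : M ≅ M) → image f (pred A) ≐ pred B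

  -- K is a functor into Aut M. Since subsets are predicates here, K-cong is what
  -- makes K a map on isomorphisms between subsets, independent of how the subsets
  -- (and their finite generation) are presented.
  record UniformlyHomogeneous : Set (suc ℓ) where
    field
      K         : (A B : FGSubstructure M) → ⟦ A ⟧ ≅ ⟦ B ⟧ → M ≅ M
      K-cong    : ∀ A B A′ B′ (f : ⟦ A ⟧ ≅ ⟦ B ⟧) (f′ : ⟦ A′ ⟧ ≅ ⟦ B′ ⟧) →
                  SameArrow A B A′ B′ f f′ → K A B f ≈ K A′ B′ f′
      K-id      : ∀ A → K A A (≅-refl ⟦ A ⟧) ≈ ε
      K-extends : ∀ A B (f : ⟦ A ⟧ ≅ ⟦ B ⟧) → Extends A B (K A B f) f
      K-∘       : ∀ C A B (f : ⟦ A ⟧ ≅ ⟦ B ⟧) (g : ⟦ C ⟧ ≅ ⟦ A ⟧) →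
                  K C B (f ∘≅ g) ≈ (K A B f ∙ K C A g)

{-# OPTIONS --safe #-}
-- Choose a representative in each isomorphism class of finitely generated
-- substructures and, by set-homogeneity, an automorphism φ_A of M carrying the
-- representative R of the class of A onto A. Then
--   K f = φ_B ∙ E_R (φ_B⁻¹ ∘ f ∘ φ_A) ∙ φ_A⁻¹   for f : A ≅ B.
-- Countability makes the choices definable: finitely generated substructures are
-- indexed by natural numbers, and least indices are taken throughout, so that φ_A
-- depends on A only as a subset of M.
module Submission where

open import Defs
open import Level using (Level)
open import Algebra.Bundles using (Group)
open import Algebra.Morphism.Structures using (module GroupMorphisms)
import Algebra.Properties.Group as GroupProperties
open import Axiom.ExcludedMiddle using (ExcludedMiddle)
open import Data.List.Base using (List; []; _∷_; map; mapMaybe)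
open import Data.List.Relation.Binary.Pointwise as Pointwise
  using (Pointwise; []; _∷_; Any-resp-Pointwise)
open import Data.List.Relation.Unary.Any using (Any)
open import Data.Maybe.Base using (Maybe; just; nothing)
open import Data.Nat.Base using (ℕ; zero; suc; _≤_; z≤n; s≤s)
open import Data.Nat.Properties using (≤-antisym)
open import Data.Product.Base using (∃; _×_; _,_; proj₁; proj₂)
open import Function.Base using (_∘_; id)
open import Function.Bundles using (Injection; _⇔_; mk⇔)
open import Relation.Binary.PropositionalEquality.Core as ≡ using (_≡_; cong)
open import Relation.Nullary.Decidable.Core using (Dec; yes; no)
open import Relation.Nullary.Negation.Core using (contradiction)
open import Relation.Unary using (Pred; Decidable; _∈_; _⊆_; _≐_)
open import Relation.Unary.Properties using (≐-sym; ≐-trans)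

private
  variable
    ℓ : Level

-- Least witnesses of decidable predicates on the naturals.

record Least (P : Pred ℕ ℓ) : Set ℓ where
  field
    value   : ℕ
    holds   : P value
    minimal : ∀ {n} → P n → value ≤ n

least : {P : Pred ℕ ℓ} → Decidable P → ∀ {n} → P n → Least P
least P? {n} p with P? 0
... | yes p₀ = record { value = 0 ; holds = p₀ ; minimal = λ _ → z≤n }
least P? {zero}  p | no ¬p₀ = contradiction p ¬p₀
least P? {suc n} p | no ¬p₀ = record
  { value   = suc L.value
  ; holds   = L.holds
  ; minimal = λ { {zero} q → contradiction q ¬p₀ ; {suc _} q → s≤s (L.minimal q) }
  }
  where module L = Least (least (P? ∘ suc) p)

-- Each value satisfies the other predicate, so minimality applies both ways. This is what makes
-- later choices independent of how a subset is presented.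
least-unique : {P Q : Pred ℕ ℓ} → P ≐ Q → (l : Least P) (m : Least Q) →
               Least.value l ≡ Least.value m
least-unique (P⊆Q , Q⊆P) l m = ≤-antisym
  (Least.minimal l (Q⊆P (Least.holds m)))
  (Least.minimal m (P⊆Q (Least.holds l)))

-- Enumeration of the finite lists of naturals.

-- a₀ ∷ a₁ ∷ … stands for the number with binary digits 0^a₀ 1 0^a₁ 1 …, least
-- significant first.
increment : List ℕ → List ℕ
double    : List ℕ → List ℕ

increment []           = 0 ∷ []
increment (zero  ∷ as) = double (increment as)
increment (suc a ∷ as) = 0 ∷ a ∷ as

double []       = []
double (a ∷ as) = suc a ∷ as

increment-double : ∀ as → increment (double as) ≡ 0 ∷ as
increment-double []       = ≡.refl
increment-double (a ∷ as) = ≡.refl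

nthList : ℕ → List ℕ
nthList zero    = []
nthList (suc n) = increment (nthList n)

-- The witness is 2n. When n grows by one it takes two increments: the first sets the lowest digit,
-- the second clears it and carries into the rest.
nthList-double : ∀ n → ∃ λ m → nthList m ≡ double (nthList n)
nthList-double zero    = 0 , ≡.refl
nthList-double (suc n) with m , eq ← nthList-double n =
  suc (suc m) ,
  cong increment (≡.trans (cong increment eq) (increment-double (nthList n)))

-- The number is read off the list: a head `zero` marks 2n + 1, where n is the number of the tail,
-- and a head `suc a` marks twice the number of `a ∷ as`.
nthList-surjective : ∀ as → ∃ λ n → nthList n ≡ as
nthList-surjective []           = 0 , ≡.refl
nthList-surjective (zero ∷ as)
  with n , ≡.refl ← nthList-surjective as
  with m , eq ← nthList-double n =
  suc m , ≡.trans (cong increment eq) (increment-double (nthList n))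
nthList-surjective (suc a ∷ as)
  with n , eq ← nthList-surjective (a ∷ as)
  with m , eq′ ← nthList-double n =
  m , ≡.trans eq′ (cong double eq)

-- Restricted automorphisms and generated substructures.

module _ {L : Language ℓ} {M : Structure L} where
  open Structure M
  open FGSubstructure using (pred; resp)

  restrict : (A B : FGSubstructure M) (F : M ≅ M) →
             image {M = M} F (pred A) ≐ pred B → ⟦ A ⟧ ≅ ⟦ B ⟧
  restrict A B F (F[A]⊆B , B⊆F[A]) = record
    { underlying = record
      { to        = λ (x , x∈A) → F.to x , F[A]⊆B (x , x∈A , refl)
      ; from      = λ (y , y∈B) → F.from y , F⁻¹[B]⊆A y∈B
      ; to-cong   = F.to-cong
      ; from-cong = F.from-cong
      ; inverse   = (λ p → F.inverseˡ p) , (λ p → F.inverseʳ p)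
      }
    ; preserves-fun = λ s v → F.preserves-fun s (proj₁ ∘ v)
    ; preserves-rel = λ r v → F.preserves-rel r (proj₁ ∘ v)
    }
    where
      module F = _≅_ F

      F⁻¹[B]⊆A : ∀ {y} → y ∈ pred B → F.from y ∈ pred A
      F⁻¹[B]⊆A y∈B with x , x∈A , Fx≈y ← B⊆F[A] y∈B =
        resp A (sym (F.inverseʳ (sym Fx≈y))) x∈A

  image-id : {P : Pred Carrier ℓ} → (∀ {x y} → x ≈ y → P x → P y) →
             image {M = M} (≅-refl M) P ≐ P
  image-id P-resp = (λ (x , x∈P , x≈y) → P-resp x≈y x∈P) ,
                    (λ {y} y∈P → y , y∈P , refl)

  ≐⇒≅ : (A B : FGSubstructure M) → pred A ≐ pred B → ⟦ A ⟧ ≅ ⟦ B ⟧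
  ≐⇒≅ A B A≐B = restrict A B (≅-refl M) (≐-trans (image-id (resp A)) A≐B)

  Generated-mono : ∀ {xs ys} → (∀ {x} → Any (x ≈_) xs → Any (x ≈_) ys) →
                   Generated M xs ⊆ Generated M ys
  Generated-mono xs⊆ys (generator x∈xs)  = generator (xs⊆ys x∈xs)
  Generated-mono xs⊆ys (operation s v p) =
    operation s v (λ i → Generated-mono xs⊆ys (p i))
  Generated-mono xs⊆ys (respects x≈y p)  = respects x≈y (Generated-mono xs⊆ys p)

  Generated-resp-Pointwise : ∀ {xs ys} → Pointwise _≈_ xs ys →
                             Generated M xs ≐ Generated M ys
  Generated-resp-Pointwise xs≋ys =
    Generated-mono (Any-resp-Pointwise (λ p q → trans q p) xs≋ys) ,
    Generated-mono (Any-resp-Pointwise (λ p q → trans q p)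
                                       (Pointwise.symmetric sym xs≋ys))

  generated : List Carrier → FGSubstructure M
  generated xs = record
    { substructure = record
      { pred   = Generated M xs
      ; resp   = respects
      ; closed = operation
      }
    ; finitelyGenerated = xs , id , id
    }

-- Representatives and charts.

module _ {L : Language ℓ} (M : Structure L) where
  open Structure M
  open FGSubstructure using (pred)

  HasExtendingHom : FGSubstructure M → Set ℓ
  HasExtendingHom A = ∃ λ (E : ⟦ A ⟧ ≅ ⟦ A ⟧ → M ≅ M) →
    GroupMorphisms.IsGroupHomomorphism
      (Group.rawGroup (Aut ⟦ A ⟧)) (Group.rawGroup (Aut M)) E
    × (∀ h → Extends A A (E h) h)

  -- `model (shape A)` is the representative of the class of `A`. Shapes are numbers and
  -- `chart-cong` is stated with `_≡_`, so equations of shapes can be matched on and equal charts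
  -- agree in both `to` and `from`.
  record Charts : Set (Level.suc ℓ) where
    field
      model       : ℕ → FGSubstructure M
      shape       : FGSubstructure M → ℕ
      shape-cong  : ∀ A B → ⟦ A ⟧ ≅ ⟦ B ⟧ → shape A ≡ shape B
      chart       : FGSubstructure M → M ≅ M
      chart-image : ∀ A → image {M = M} (chart A) (pred (model (shape A))) ≐ pred A
      chart-cong  : ∀ A B → pred A ≐ pred B → chart A ≡ chart B

-- From the functor to extending homomorphisms.

module _ {L : Language ℓ} {M : Structure L} where
  open Structure M
  open FGSubstructure using (pred)
  module AutM = Group (Aut M)

  -- The functor laws at the single object `A` are the homomorphism laws; inverses are preserved
  -- because a left inverse in a group is unique.
  uniformlyHomogeneous⇒extendingHom :
    UniformlyHomogeneous M → ∀ A → HasExtendingHom M A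
  uniformlyHomogeneous⇒extendingHom U A = K A A ,
    record
      { isMonoidHomomorphism = record
        { isMagmaHomomorphism = record
          { isRelHomomorphism = record { cong = λ {f} {g} → K-resp {f} {g} }
          ; homo              = K-∘ A A A
          }
        ; ε-homo = K-id A
        }
      ; ⁻¹-homo = λ f → inverseˡ-unique (K A A (≅-sym f)) (K A A f) (λ x →
          trans (sym (K-∘ A A A (≅-sym f) f x))
         (trans (K-resp {≅-sym f ∘≅ f} {≅-refl ⟦ A ⟧}
                        (Group.inverseˡ (Aut ⟦ A ⟧) f) x)
                (K-id A x)))
      } ,
    K-extends A A
    where
      open UniformlyHomogeneous U
      open GroupProperties (Aut M) using (inverseˡ-unique)

      K-resp : ∀ {f g : ⟦ A ⟧ ≅ ⟦ A ⟧} → Group._≈_ (Aut ⟦ A ⟧) f g →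
               AutM._≈_ (K A A f) (K A A g)
      K-resp {f} {g} f≈g = K-cong A A A A f g (record
        { dom = id , id
        ; cod = id , id
        -- `p` and `p′` may be different membership proofs of `x`; `to-cong` exchanges one for the
        -- other.
        ; val = λ x p p′ → trans (_≅_.to-cong f refl) (f≈g (x , p′))
        })

  -- From extending homomorphisms to the functor.

  module _ (charts : Charts M) (extend : ∀ A → HasExtendingHom M A) where
    open Charts charts
    open AutM using (_∙_)

    -- A conjugate runs between two models whose indices are only propositionally equal; matching on
    -- the equation turns it into an automorphism, to which the given homomorphism applies.
    modelExt : ∀ {i j} → i ≡ j → ⟦ model i ⟧ ≅ ⟦ model j ⟧ → M ≅ M
    modelExt {i} ≡.refl = proj₁ (extend (model i))

    private
      module E i = GroupMorphisms.IsGroupHomomorphism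
                     (proj₁ (proj₂ (extend (model i))))

    -- The two isomorphisms may have different types, so only their values in `M` are compared. The
    -- lemma also allows one proof of an index equation to be traded for another.
    modelExt-cong : ∀ {i i′ j j′} (p : i ≡ j) (p′ : i′ ≡ j′) → i ≡ i′ →
                    (h : ⟦ model i ⟧ ≅ ⟦ model j ⟧) (h′ : ⟦ model i′ ⟧ ≅ ⟦ model j′ ⟧) →
                    (∀ x q q′ → proj₁ (_≅_.to h (x , q)) ≈ proj₁ (_≅_.to h′ (x , q′))) →
                    AutM._≈_ (modelExt p h) (modelExt p′ h′)
    modelExt-cong {i} ≡.refl ≡.refl ≡.refl h h′ h≈h′ =
      E.⟦⟧-cong i {h} {h′} (λ (x , q) → h≈h′ x q q)

    modelExt-∘ : ∀ {i j k} (p : j ≡ k) (q : i ≡ j) (r : i ≡ k)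
                 (h : ⟦ model j ⟧ ≅ ⟦ model k ⟧) (g : ⟦ model i ⟧ ≅ ⟦ model j ⟧) →
                 AutM._≈_ (modelExt r (h ∘≅ g)) (modelExt p h ∙ modelExt q g)
    modelExt-∘ {i} ≡.refl ≡.refl ≡.refl = E.homo i

    modelExt-id : ∀ {i} (p : i ≡ i) →
                  AutM._≈_ (modelExt p (≅-refl ⟦ model i ⟧)) AutM.ε
    modelExt-id {i} ≡.refl = E.ε-homo i

    modelExt-extends : ∀ {i j} (p : i ≡ j) (h : ⟦ model i ⟧ ≅ ⟦ model j ⟧) →
                       Extends (model i) (model j) (modelExt p h) h
    modelExt-extends {i} ≡.refl = proj₂ (proj₂ (extend (model i)))

    private
      module chart A = _≅_ (chart A)

    chart∣ : ∀ A → ⟦ model (shape A) ⟧ ≅ ⟦ A ⟧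
    chart∣ A = restrict (model (shape A)) A (chart A) (chart-image A)

    conjugate : ∀ A B → ⟦ A ⟧ ≅ ⟦ B ⟧ → ⟦ model (shape A) ⟧ ≅ ⟦ model (shape B) ⟧
    conjugate A B f = ≅-sym (chart∣ B) ∘≅ f ∘≅ chart∣ A

    functor : ∀ A B → ⟦ A ⟧ ≅ ⟦ B ⟧ → M ≅ M
    functor A B f =
      chart B ∘≅ modelExt (shape-cong A B f) (conjugate A B f) ∘≅ ≅-sym (chart A)

    -- The outer charts coincide by `chart-cong`, and the identity between `A` and `A′` makes their
    -- shapes equal. What remains is agreement of the conjugates, which comes from `val`.
    functor-cong : ∀ A B A′ B′ (f : ⟦ A ⟧ ≅ ⟦ B ⟧) (f′ : ⟦ A′ ⟧ ≅ ⟦ B′ ⟧) →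
                   SameArrow A B A′ B′ f f′ →
                   AutM._≈_ (functor A B f) (functor A′ B′ f′)
    functor-cong A B A′ B′ f f′ same x = trans
      (chart.to-cong B (trans
        (modelExt-cong (shape-cong A B f) (shape-cong A′ B′ f′)
          (shape-cong A A′ (≐⇒≅ A A′ dom))
          (conjugate A B f) (conjugate A′ B′ f′) conjugate-cong _)
        (_≅_.to-cong (modelExt (shape-cong A′ B′ f′) (conjugate A′ B′ f′))
          (from-≡ (chart-cong A A′ dom) x))))
      (to-≡ (chart-cong B B′ cod) _)
      where
        open SameArrow same

        to-≡ : ∀ {F G : M ≅ M} → F ≡ G → ∀ y → _≅_.to F y ≈ _≅_.to G y
        to-≡ ≡.refl y = refl

        from-≡ : ∀ {F G : M ≅ M} → F ≡ G → ∀ y → _≅_.from F y ≈ _≅_.from G y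
        from-≡ ≡.refl y = refl

        conjugate-cong : ∀ y q q′ → proj₁ (_≅_.to (conjugate A B f) (y , q)) ≈
                                    proj₁ (_≅_.to (conjugate A′ B′ f′) (y , q′))
        conjugate-cong y q q′ = trans
          (chart.from-cong B (trans
            (val _ _ (proj₁ dom (proj₂ (_≅_.to (chart∣ A) (y , q)))))
            (_≅_.to-cong f′ (to-≡ (chart-cong A A′ dom) y))))
          (from-≡ (chart-cong B B′ cod) _)

    functor-id : ∀ A → AutM._≈_ (functor A A (≅-refl ⟦ A ⟧)) AutM.ε
    functor-id A x = trans
      (chart.to-cong A (trans
        -- Trades the opaque loop on `shape A` for `refl`, and the conjugated identity for the
        -- identity.
        (modelExt-cong (shape-cong A A (≅-refl ⟦ A ⟧)) ≡.refl ≡.refl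
          (conjugate A A (≅-refl ⟦ A ⟧)) (≅-refl ⟦ model (shape A) ⟧)
          (λ y q q′ → chart.inverseʳ A refl) _)
        (modelExt-id ≡.refl _)))
      (chart.inverseˡ A refl)

    -- The inverse chart sends `a` into the model, where the extension agrees with the conjugate;
    -- both charts then cancel.
    functor-extends : ∀ A B (f : ⟦ A ⟧ ≅ ⟦ B ⟧) → Extends A B (functor A B f) f
    functor-extends A B f a = trans
      (chart.to-cong B
        (modelExt-extends (shape-cong A B f) (conjugate A B f)
                          (_≅_.from (chart∣ A) a)))
      (chart.inverseˡ B (chart.from-cong B (_≅_.to-cong f (chart.inverseˡ A refl))))

    -- The chart of `A` cancels against its inverse twice: inside the product of the conjugates, and
    -- between the two extensions in `M`.
    functor-∘ : ∀ C A B (f : ⟦ A ⟧ ≅ ⟦ B ⟧) (g : ⟦ C ⟧ ≅ ⟦ A ⟧) →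
                AutM._≈_ (functor C B (f ∘≅ g)) (functor A B f ∙ functor C A g)
    functor-∘ C A B f g x = chart.to-cong B (trans
      (modelExt-cong pfg pfg ≡.refl
        (conjugate C B (f ∘≅ g)) (conjugate A B f ∘≅ conjugate C A g)
        (λ y q q′ → chart.from-cong B (_≅_.to-cong f
           (trans (_≅_.to-cong g refl) (sym (chart.inverseˡ A refl))))) _)
      (trans
        (modelExt-∘ (shape-cong A B f) (shape-cong C A g) pfg
                    (conjugate A B f) (conjugate C A g) _)
        (_≅_.to-cong (modelExt (shape-cong A B f) (conjugate A B f))
          (sym (chart.inverseʳ A refl)))))
      where
        pfg : shape C ≡ shape B
        pfg = shape-cong C B (f ∘≅ g)

    charts⇒uniformlyHomogeneous : UniformlyHomogeneous M
    charts⇒uniformlyHomogeneous = record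
      { K         = functor
      ; K-cong    = functor-cong
      ; K-id      = functor-id
      ; K-extends = functor-extends
      ; K-∘       = functor-∘
      }

  -- Charts from countability and set-homogeneity.

  module _ (em : ExcludedMiddle ℓ) (countable : Countable M) where
    open Injection countable using () renaming (to to code; injective to code-injective)

    -- Numbers that code nothing give `nothing` rather than a default element, as `Carrier` may be
    -- empty. The decision is an argument so that case analysis on `em` makes `decode` reduce.
    decode : ∀ {n} → Dec (∃ λ x → code x ≡ n) → Maybe Carrier
    decode (yes (x , _)) = just x
    decode (no _)        = nothing

    decodeList : List ℕ → List Carrier
    decodeList = mapMaybe (λ n → decode {n} em)

    -- Decoding `code x` may return another element with the same code; injectivity makes it equal
    -- to `x` up to `_≈_`.
    decodeList-map-code : ∀ xs → Pointwise _≈_ xs (decodeList (map code xs))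
    decodeList-map-code []       = []
    decodeList-map-code (x ∷ xs) with em {∃ λ y → code y ≡ code x}
    ... | yes (y , eq) = code-injective (≡.sym eq) ∷ decodeList-map-code xs
    ... | no ∄y        = contradiction (x , ≡.refl) ∄y

    nthFG : ℕ → FGSubstructure M
    nthFG n = generated (decodeList (nthList n))

    -- The codes of a finite generating list form a list of naturals, which the enumeration reaches.
    -- Decoding alters the generators only up to `_≈_`, which leaves the generated subset unchanged.
    nthFG-surjective : ∀ A → ∃ λ n → pred A ≐ pred (nthFG n)
    nthFG-surjective A
      with xs , A≐⟨xs⟩ ← FGSubstructure.finitelyGenerated A
      with n , eq ← nthList-surjective (map code xs) =
      n , ≐-trans A≐⟨xs⟩
        (≡.subst (λ as → Generated M xs ≐ Generated M (decodeList as)) (≡.sym eq)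
          (Generated-resp-Pointwise (decodeList-map-code xs)))

    -- The index found by surjectivity depends on the generators stored in `A`; the least one
    -- depends on the subset alone.
    leastIndex : ∀ A → Least (λ n → pred A ≐ pred (nthFG n))
    leastIndex A with n , A≐nth ← nthFG-surjective A =
      least (λ _ → em) {n} A≐nth

    module index A = Least (leastIndex A)

    index-cong : ∀ A B → pred A ≐ pred B → index.value A ≡ index.value B
    index-cong A B A≐B = least-unique
      ((λ p → ≐-trans (≐-sym A≐B) p) , (λ p → ≐-trans A≐B p))
      (leastIndex A) (leastIndex B)

    -- Selects the representative of an isomorphism class: the first member of the enumeration that
    -- lies in it.
    leastCopy : ∀ n → Least (λ m → ⟦ nthFG m ⟧ ≅ ⟦ nthFG n ⟧)
    leastCopy n = least (λ _ → em) {n} (≅-refl ⟦ nthFG n ⟧)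

    module copy n = Least (leastCopy n)

    copy-cong : ∀ m n → ⟦ nthFG m ⟧ ≅ ⟦ nthFG n ⟧ → copy.value m ≡ copy.value n
    copy-cong m n f = least-unique ((f ∘≅_) , (≅-sym f ∘≅_)) (leastCopy m) (leastCopy n)

    setHomogeneous⇒charts : SetHomogeneous M → Charts M
    setHomogeneous⇒charts homogeneous = record
      { model       = nthFG
      ; shape       = λ A → copy.value (index.value A)
      ; shape-cong  = λ A B f → copy-cong (index.value A) (index.value B)
          (≐⇒≅ B (nthFG (index.value B)) (index.holds B) ∘≅ f ∘≅
           ≐⇒≅ (nthFG (index.value A)) A (≐-sym (index.holds A)))
      ; chart       = λ A → proj₁ (move (index.value A))
      ; chart-image = λ A → ≐-trans (proj₂ (move (index.value A))) (≐-sym (index.holds A))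
      ; chart-cong  = λ A B A≐B → cong (proj₁ ∘ move) (index-cong A B A≐B)
      }
      where
        -- Set-homogeneity is applied to indices rather than to substructures, so that equal indices
        -- yield the very same automorphism.
        move : ∀ n → ∃ λ (F : M ≅ M) →
               image {M = M} F (pred (nthFG (copy.value n))) ≐ pred (nthFG n)
        move n = homogeneous (nthFG (copy.value n)) (nthFG n) (copy.holds n)

proposition1p1 : {ℓ : Level} → ExcludedMiddle ℓ →
    (L : Language ℓ) (M : Structure L) → Countable M → SetHomogeneous M →
    UniformlyHomogeneous M ⇔
    ((A : FGSubstructure M) →
    ∃ λ (E : ⟦ A ⟧ ≅ ⟦ A ⟧ → M ≅ M) →
    GroupMorphisms.IsGroupHomomorphism
    (Group.rawGroup (Aut ⟦ A ⟧)) (Group.rawGroup (Aut M)) E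
    × (∀ h → Extends A A (E h) h))
proposition1p1 em L M countable homogeneous = mk⇔
  uniformlyHomogeneous⇒extendingHom
  (charts⇒uniformlyHomogeneous (setHomogeneous⇒charts em countable homogeneous))
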